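{- There is a constant $C$ such that for all $n\ge 1$, $q(n;\mathit{trees})\ge\log^*n-\log^*\log^*n-C$.
   Context: The tower function is $T(0)=1$, $T(i)=2^{T(i-1)}$; $\log^* n=\min\{i: T(i)\ge n\}$. Graphs are simple undirected graphs viewed as structures for the first-order language with adjacency symbol $\sim$ and equality. A sentence defines a finite graph $G$ if it is true on $G$ and false on every graph (of any cardinality) not isomorphic to $G$; $D(G)$ is the minimum quantifier rank of a sentence defining $G$. $q(n;\mathit{trees})=\min\{D(T): T\text{ a tree with } n\text{ vertices}\}$. -}

module Defs where

open import Data.Fin using (Fin; zero; suc; inject₁; fromℕ)
open import Data.Nat using (ℕ; zero; suc; _+_; _^_; _≤_; _<_; _⊔_; z≤n; s≤s; _≤?_)
open import Data.Nat.Properties using (≤-trans; <⇒≤; m^n>0; +-mono-≤; +-identityʳ)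
open import Data.Product using (Σ; ∃; ∃-syntax; _×_; _,_; proj₁)
open import Data.Sum using (_⊎_; inj₁; inj₂)
open import Data.Vec using (Vec; []; _∷_; lookup)
open import Function.Bundles using (_↔_; _⇔_; Inverse)
open import Function.Definitions using (Injective)
open import Level using (Level) renaming (suc to lsuc)
open import Relation.Binary.Construct.Closure.ReflexiveTransitive using (Star)
open import Relation.Binary.Definitions using (Symmetric)
open import Relation.Binary.PropositionalEquality using (_≡_)
open import Relation.Nullary using (¬_; yes; no; contradiction)
open import Relation.Unary using (Pred; Decidable)

private
  variable
    a ℓ : Level
    n : ℕ

-- `IsMin P k` says k = min { i : P i }.  Minima of undecidable predicates
-- cannot be computed constructively, so they are handled as relations.
IsMin : Pred ℕ a → Pred ℕ a
IsMin P k = P k × (∀ i → P i → k ≤ i)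

least : {P : Pred ℕ a} → Decidable P → ∀ m → P m → ∃ (IsMin P)
least P? zero pm = zero , pm , λ _ _ → z≤n
least {P = P} P? (suc m) pm with P? zero
... | yes p0 = zero , p0 , λ _ _ → z≤n
... | no ¬p0 with least {P = λ i → P (suc i)} (λ i → P? (suc i)) m pm
...   | k , pk , min = suc k , pk , λ where
          zero p0 → contradiction p0 ¬p0
          (suc i) pi → s≤s (min i pi)

Tower : ℕ → ℕ
Tower zero    = 1
Tower (suc i) = 2 ^ Tower i

n<2^n : ∀ n → n < 2 ^ n
n<2^n zero    = s≤s z≤n
n<2^n (suc n) rewrite +-identityʳ (2 ^ n) = +-mono-≤ (m^n>0 2 n) (n<2^n n)

n<Tower : ∀ n → n < Tower n
n<Tower zero    = s≤s z≤n
n<Tower (suc n) = ≤-trans (s≤s (n<Tower n)) (n<2^n (Tower n))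

log*-least : ∀ n → ∃ (IsMin (λ i → n ≤ Tower i))
log*-least n = least (λ i → n ≤? Tower i) n (<⇒≤ (n<Tower n))

log* : ℕ → ℕ
log* n = proj₁ (log*-least n)

-- Vertices are compared by _≡_.  No finiteness or decidability is assumed,
-- so `Graph ℓ` contains the graphs of every cardinality available in `Set ℓ`.
record Graph (ℓ : Level) : Set (lsuc ℓ) where
  infix 4 _∼_
  field
    Vertex  : Set ℓ
    _∼_     : Vertex → Vertex → Set ℓ
    ∼-sym   : Symmetric _∼_
    ∼-irrefl : ∀ x → ¬ (x ∼ x)

open Graph using (Vertex)

record _≅_ (G H : Graph ℓ) : Set ℓ where
  private
    module G = Graph G
    module H = Graph H
  field
    bijection : G.Vertex ↔ H.Vertex
  open Inverse bijection public using (to)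
  field
    adjacency : ∀ x y → (x G.∼ y) ⇔ (to x H.∼ to y)

HasOrder : Graph ℓ → ℕ → Set ℓ
HasOrder G n = Vertex G ↔ Fin n

module _ (G : Graph ℓ) where
  open Graph G using (_∼_)

  Connected : Set ℓ
  Connected = Vertex G × (∀ x y → Star _∼_ x y)

  record Cycle : Set ℓ where
    field
      excess   : ℕ -- the cycle has 3 + excess vertices
      vertex   : Fin (3 + excess) → Vertex G
      distinct : Injective _≡_ _≡_ vertex
      edge     : ∀ (i : Fin (2 + excess)) → vertex (inject₁ i) ∼ vertex (suc i)
      closing  : vertex (fromℕ (2 + excess)) ∼ vertex zero

  IsTree : Set ℓ
  IsTree = Connected × ¬ Cycle

-- Formulas with free variables among n, as de Bruijn indices.
infix  7 _∼′_ _≐_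
infix  6 ¬′_
infixr 5 _∧′_
infixr 4 _∨′_
infixr 3 _⇒′_

data Formula (n : ℕ) : Set where
  _∼′_ _≐_          : (i j : Fin n) → Formula n
  ¬′_               : Formula n → Formula n
  _∧′_ _∨′_ _⇒′_    : (φ ψ : Formula n) → Formula n
  ∀′ ∃′             : Formula (suc n) → Formula n

Sentence : Set
Sentence = Formula 0

rank : Formula n → ℕ
rank (i ∼′ j) = 0
rank (i ≐ j)  = 0
rank (¬′ φ)   = rank φ
rank (φ ∧′ ψ) = rank φ ⊔ rank ψ
rank (φ ∨′ ψ) = rank φ ⊔ rank ψ
rank (φ ⇒′ ψ) = rank φ ⊔ rank ψ
rank (∀′ φ)   = suc (rank φ)
rank (∃′ φ)   = suc (rank φ)

Sat : (G : Graph ℓ) → Vec (Vertex G) n → Formula n → Set ℓ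
Sat G ρ (i ∼′ j) = Graph._∼_ G (lookup ρ i) (lookup ρ j)
Sat G ρ (i ≐ j)  = lookup ρ i ≡ lookup ρ j
Sat G ρ (¬′ φ)   = ¬ Sat G ρ φ
Sat G ρ (φ ∧′ ψ) = Sat G ρ φ × Sat G ρ ψ
Sat G ρ (φ ∨′ ψ) = Sat G ρ φ ⊎ Sat G ρ ψ
Sat G ρ (φ ⇒′ ψ) = Sat G ρ φ → Sat G ρ ψ
Sat G ρ (∀′ φ)   = ∀ x → Sat G (x ∷ ρ) φ
Sat G ρ (∃′ φ)   = ∃[ x ] Sat G (x ∷ ρ) φ

infix 4 _⊨_
_⊨_ : Graph ℓ → Sentence → Set ℓ
G ⊨ φ = Sat G [] φ

Defines : Sentence → Graph ℓ → Set (lsuc ℓ)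
Defines {ℓ} φ G = G ⊨ φ × (∀ (H : Graph ℓ) → ¬ (H ≅ G) → ¬ (H ⊨ φ))

-- `D-is G k` reads D(G) = k.
D-is : Graph ℓ → ℕ → Set (lsuc ℓ)
D-is G = IsMin (λ r → ∃[ φ ] Defines φ G × rank φ ≡ r)

-- `q-trees-is ℓ n k` reads q(n; trees) = k, with all graphs ranging over `Graph ℓ`.
q-trees-is : (ℓ : Level) → ℕ → ℕ → Set (lsuc ℓ)
q-trees-is ℓ n = IsMin (λ d → Σ (Graph ℓ) λ T → IsTree T × HasOrder T n × D-is T d)

{-# OPTIONS --safe #-}
-- Every finite tree is built from single vertices by the operation s ⊲ t, which hangs the rooted
-- tree t below the root of s, and the rank-k type of s ⊲ t depends only on those of s and t.  If
-- there are N rank-k types of rooted trees, a term of depth at least N has two nested subterms of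
-- the same type; putting the inner one in place of the outer one yields a smaller tree of the same
-- type.  Hence a tree defined by a sentence of rank k has at most 2 ^ N vertices.  Since N is a k-fold
-- iterated exponential of a polynomial in k, this gives log* n ≤ k + log* k + O(1), and one may
-- assume k ≤ log* n.
module Submission where

open import Data.Bool using (if_then_else_)
open import Data.Empty.Polymorphic using (⊥)
open import Data.Fin as Fin using (Fin; zero; suc; inject₁; fromℕ; combine; funToFin; finToFun)
open import Data.Fin.Properties as Fin
  using (combine-injective; finToFun-funToFin; pigeonhole; injective⇒≤; +↔⊎; suc-injective)
open import Data.Maybe using (Maybe; just; nothing; maybe; map)
open import Data.Maybe.Properties using (just-injective; map-injective)
open import Data.Nat using (ℕ; zero; suc; _+_; _*_; _^_; _≤_; _<_; _⊔_; z≤n; s≤s; _≤?_)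
open import Data.Nat.Properties
  using (≤-refl; ≤-trans; ≤-total; <⇒≤; <⇒≱; ≰⇒>; m≤n+m; m≤m+n; m<m+n; m<n+m; +-mono-≤; +-mono-<-≤;
         +-mono-≤-<; *-mono-≤; *-monoʳ-≤; ^-monoʳ-≤; ^-*-assoc; ^-distribˡ-+-*; +-suc; +-comm;
         +-assoc; +-identityʳ; m⊔n≤o⇒m≤o; m⊔n≤o⇒n≤o; m≤m⊔n; m≤n⊔m; ⊔-sel; module ≤-Reasoning)
open import Data.Product.Function.NonDependent.Propositional using (_×-⇔_)
open import Data.Product using (Σ; ∃; ∃-syntax; _×_; _,_; proj₁; proj₂; swap)
open import Data.Sum using (_⊎_; inj₁; inj₂)
import Data.Sum
open import Data.Sum.Function.Propositional using (_⊎-↔_)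
open import Data.Vec using (Vec; []; _∷_; lookup)
open import Function using (_∘_; id)
open import Function.Bundles using (_↔_; _⇔_; Injection; Inverse; Equivalence; mk⇔; mk↔ₛ′)
open import Function.Construct.Composition using (_⇔-∘_; _↔-∘_)
open import Function.Construct.Symmetry using (↔-sym)
open import Function.Construct.Identity using (⇔-id)
open import Function.Properties.Inverse using (↔⇒↣)
open import Function.Definitions using (Injective)
open import Level using (Level)
open import Relation.Binary.Construct.Closure.ReflexiveTransitive using (Star; ε; _◅_; _◅◅_; gmap)
open import Relation.Binary.Definitions using (DecidableEquality)
open import Relation.Binary.PropositionalEquality using (_≡_; _≢_; refl; sym; trans; cong; subst)
open import Relation.Nullary using (¬_; Dec; yes; no; contradiction)
open import Relation.Nullary.Decidable using (map′; ¬?; _×-dec_; _⊎-dec_; does; decidable-stable; via-injection)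
open import Relation.Unary using (Pred; Decidable)
open import Defs
open Graph using (Vertex; ∼-irrefl)
open Equivalence using (to; from)

private
  variable
    a b p ℓ : Level
    m n k M N : ℕ

-- Ehrenfeucht–Fraïssé games

-- A position is kept as a relation rather than a list of pebbles: positions are then comparable by
-- inclusion, and order and repetition of pebbles are forgotten.
Insert : {A B : Set ℓ} → (A → B → Set ℓ) → A → B → A → B → Set ℓ
Insert R x y x′ y′ = R x′ y′ ⊎ (x′ ≡ x × y′ ≡ y)

module _ (G H : Graph ℓ) where
  private
    module G = Graph G
    module H = Graph H

  Pairing : Set _
  Pairing = G.Vertex → H.Vertex → Set ℓ

  IsPartialIso : Pairing → Set ℓ
  IsPartialIso R = ∀ {x x′ y y′} → R x y → R x′ y′ →
    (x ≡ x′ ⇔ y ≡ y′) × (x G.∼ x′ ⇔ y H.∼ y′)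

  -- Duplicator survives k rounds from the position whose pebbled pairs are R.
  EF : ℕ → Pairing → Set ℓ
  EF zero    R = IsPartialIso R
  EF (suc k) R = (∀ x → ∃[ y ] EF k (Insert R x y)) × (∀ y → ∃[ x ] EF k (Insert R x y))

module _ {G H : Graph ℓ} where

  Insert-mono : {R S : Pairing G H} → (∀ x y → R x y → S x y) →
    ∀ {u v} x y → Insert R u v x y → Insert S u v x y
  Insert-mono R⊆S x y (inj₁ r)  = inj₁ (R⊆S x y r)
  Insert-mono R⊆S x y (inj₂ eq) = inj₂ eq

  -- Fewer pebbled pairs impose fewer constraints at the end, so Duplicator keeps the same strategy.
  EF-antitone : ∀ k {R S : Pairing G H} → (∀ x y → R x y → S x y) → EF G H k S → EF G H k R
  EF-antitone zero    R⊆S e = λ r r′ → e (R⊆S _ _ r) (R⊆S _ _ r′)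
  EF-antitone (suc k) R⊆S (forth , back) =
    (λ x → let y , e = forth x in y , EF-antitone k (Insert-mono R⊆S) e) ,
    (λ y → let x , e = back y in x , EF-antitone k (Insert-mono R⊆S) e)

  -- One round is spent on an arbitrary vertex and the resulting pair is then forgotten.
  EF-pred : Vertex G → {R : Pairing G H} → EF G H (suc k) R → EF G H k R
  EF-pred {k = k} x (forth , _) = EF-antitone k (λ _ _ → inj₁) (proj₂ (forth x))

  EF⇒partialIso : Vertex G → ∀ k {R : Pairing G H} → EF G H k R → IsPartialIso G H R
  EF⇒partialIso x zero    e = e
  EF⇒partialIso x (suc k) e = EF⇒partialIso x k (EF-pred x e)

  insert-lookup : (R : Pairing G H) {ρ : Vec (Vertex G) m} {σ : Vec (Vertex H) m} →
    (∀ i → R (lookup ρ i) (lookup σ i)) → ∀ {x y} i → Insert R x y (lookup (x ∷ ρ) i) (lookup (y ∷ σ) i)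
  insert-lookup R r zero    = inj₂ (refl , refl)
  insert-lookup R r (suc i) = inj₁ (r i)

  -- Induction on the formula: connectives stay at the same position, and each quantifier costs one
  -- round, with Duplicator's answer serving as the witness or instance on the other side.
  Sat-transfer : (φ : Formula m) {R : Pairing G H} {ρ : Vec (Vertex G) m} {σ : Vec (Vertex H) m} →
    rank φ ≤ k → EF G H k R → (∀ i → R (lookup ρ i) (lookup σ i)) → Sat G ρ φ ⇔ Sat H σ φ
  Sat-transfer {k = k} (i ∼′ j) {ρ = ρ} _ e r = proj₂ (EF⇒partialIso (lookup ρ i) k e (r i) (r j))
  Sat-transfer {k = k} (i ≐ j)  {ρ = ρ} _ e r = proj₁ (EF⇒partialIso (lookup ρ i) k e (r i) (r j))
  Sat-transfer (¬′ φ) q e r = mk⇔ (λ s → s ∘ from φ⇔) (λ s → s ∘ to φ⇔)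
    where φ⇔ = Sat-transfer φ q e r
  Sat-transfer (φ ∧′ ψ) q e r =
    mk⇔ (λ (s , t) → to φ⇔ s , to ψ⇔ t) (λ (s , t) → from φ⇔ s , from ψ⇔ t)
    where
      φ⇔ = Sat-transfer φ (m⊔n≤o⇒m≤o _ _ q) e r
      ψ⇔ = Sat-transfer ψ (m⊔n≤o⇒n≤o (rank φ) _ q) e r
  Sat-transfer (φ ∨′ ψ) q e r =
    mk⇔ (Data.Sum.map (to φ⇔) (to ψ⇔)) (Data.Sum.map (from φ⇔) (from ψ⇔))
    where
      φ⇔ = Sat-transfer φ (m⊔n≤o⇒m≤o _ _ q) e r
      ψ⇔ = Sat-transfer ψ (m⊔n≤o⇒n≤o (rank φ) _ q) e r
  Sat-transfer (φ ⇒′ ψ) q e r =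
    mk⇔ (λ s → to ψ⇔ ∘ s ∘ from φ⇔) (λ s → from ψ⇔ ∘ s ∘ to φ⇔)
    where
      φ⇔ = Sat-transfer φ (m⊔n≤o⇒m≤o _ _ q) e r
      ψ⇔ = Sat-transfer ψ (m⊔n≤o⇒n≤o (rank φ) _ q) e r
  Sat-transfer (∀′ φ) {R} (s≤s q) (forth , back) r = mk⇔
    (λ s y → let x , e = back y in to (Sat-transfer φ q e (insert-lookup R r)) (s x))
    (λ s x → let y , e = forth x in from (Sat-transfer φ q e (insert-lookup R r)) (s y))
  Sat-transfer (∃′ φ) {R} (s≤s q) (forth , back) r = mk⇔
    (λ (x , s) → let y , e = forth x in y , to (Sat-transfer φ q e (insert-lookup R r)) s)
    (λ (y , s) → let x , e = back y in x , from (Sat-transfer φ q e (insert-lookup R r)) s)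

  -- Duplicator answers along the isomorphism; the invariant is that `R` lies inside its graph.
  ≅⇒EF : (i : G ≅ H) → ∀ k {R : Pairing G H} → (∀ x y → R x y → _≅_.to i x ≡ y) → EF G H k R
  ≅⇒EF i zero R⊆i r r′ with refl ← R⊆i _ _ r | refl ← R⊆i _ _ r′ =
    mk⇔ (cong (_≅_.to i)) (Injection.injective (↔⇒↣ (_≅_.bijection i))) , _≅_.adjacency i _ _
  ≅⇒EF i (suc k) {R} R⊆i =
    (λ x → _ , ≅⇒EF i k λ { u v (inj₁ r) → R⊆i u v r ; u v (inj₂ (refl , refl)) → refl }) ,
    (λ y → _ , ≅⇒EF i k λ { u v (inj₁ r) → R⊆i u v r 
                        ; u v (inj₂ (refl , refl)) → Inverse.strictlyInverseˡ (_≅_.bijection i) y })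

≅-refl : {G : Graph ℓ} → G ≅ G
≅-refl = record { bijection = mk↔ₛ′ id id (λ _ → refl) (λ _ → refl) ; adjacency = λ _ _ → mk⇔ id id }

-- Bounding the number of classes of a relation

-- An upper bound `N` on the number of classes, witnessed by labels: equal labels force related
-- elements, which is the direction the pigeonhole argument uses.
record Classifier {X : Set a} (_≈_ : X → X → Set b) (N : ℕ) : Set (a Level.⊔ b) where
  field
    classify : X → Fin N
    sound    : ∀ {x y} → classify x ≡ classify y → x ≈ y

open Classifier

module _ {X : Set a} where

  weaken : {R S : X → X → Set b} → (∀ {x y} → R x y → S x y) → Classifier R N → Classifier S N
  weaken R⊆S c = record { classify = classify c ; sound = R⊆S ∘ sound c }

  ×-classifier : {R S : X → X → Set b} → Classifier R M → Classifier S N →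
    Classifier (λ x y → R x y × S x y) (M * N)
  ×-classifier c d = record
    { classify = λ x → combine (classify c x) (classify d x)
    ; sound    = λ eq → let eqˡ , eqʳ = combine-injective _ _ _ _ eq in sound c eqˡ , sound d eqʳ
    }

  ∀-classifier : {R : Fin m → X → X → Set b} → (∀ i → Classifier (R i) N) →
    Classifier (λ x y → ∀ i → R i x y) (N ^ m)
  ∀-classifier c = record
    { classify = λ x → funToFin (λ i → classify (c i) x)
    ; sound    = λ {x} {y} eq i → sound (c i) (trans (sym (finToFun-funToFin _ i))
                   (trans (cong (λ e → finToFun e i) eq) (finToFun-funToFin _ i)))
    }

  dec-classifier : {P : Pred X p} → Decidable P → Classifier (λ x y → P x ⇔ P y) 2
  dec-classifier {P = P} P? = record { classify = bit ; sound = bit-sound }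
    where
      bit : X → Fin 2
      bit x = if does (P? x) then suc zero else zero

      bit-sound : ∀ {x y} → bit x ≡ bit y → P x ⇔ P y
      bit-sound {x} {y} eq with P? x | P? y
      ... | yes px | yes py = mk⇔ (λ _ → py) (λ _ → px)
      ... | no ¬px | no ¬py = mk⇔ (λ px → contradiction px ¬px) (λ py → contradiction py ¬py)
      bit-sound () | yes _ | no _
      bit-sound () | no _  | yes _

-- Simple paths

module _ {G : Graph ℓ} where
  private module G = Graph G

  -- The walk is scanned up to its first vertex outside `P`; the edge entering that vertex is the
  -- one returned.
  crossing : {P : Pred (Vertex G) p} → Decidable P → ∀ {x y} → P x → ¬ P y → Star G._∼_ x y →
    ∃[ u ] ∃[ v ] (P u × ¬ P v × u G.∼ v)
  crossing P? px ¬py ε = contradiction px ¬py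
  crossing P? px ¬py (_◅_ {j = z} e es) with P? z
  ... | yes pz = crossing P? pz ¬py es
  ... | no ¬pz = _ , _ , px , ¬pz , e

module _ (G : Graph ℓ) where
  private module G = Graph G

  record SimplePath (n : ℕ) (x y : Vertex G) : Set ℓ where
    field
      vertex   : Fin (suc n) → Vertex G
      start    : vertex zero ≡ x
      end      : vertex (fromℕ n) ≡ y
      distinct : Injective _≡_ _≡_ vertex
      edge     : ∀ (i : Fin n) → vertex (inject₁ i) G.∼ vertex (suc i)

open SimplePath

module _ {G : Graph ℓ} where
  private
    module G = Graph G
    variable
      x y z : Vertex G

  trivialPath : ∀ x → SimplePath G 0 x x
  trivialPath x = record
    { vertex = λ _ → x ; start = refl ; end = refl ; distinct = λ { {zero} {zero} _ → refl } ; edge = λ () }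

  consPath : x G.∼ y → (p : SimplePath G n y z) → (∀ i → vertex p i ≢ x) → SimplePath G (suc n) x z
  consPath {x = x} x∼y p x∉p = record
    { vertex   = λ { zero → x ; (suc i) → vertex p i }
    ; start    = refl
    ; end      = end p
    ; distinct = λ { {zero}  {zero}  _  → refl
                   ; {zero}  {suc j} eq → contradiction (sym eq) (x∉p j)
                   ; {suc i} {zero}  eq → contradiction eq (x∉p i)
                   ; {suc i} {suc j} eq → cong suc (distinct p eq) }
    ; edge     = λ { zero → subst (x G.∼_) (sym (start p)) x∼y ; (suc i) → edge p i }
    }

  suffix : (p : SimplePath G n x y) (i : Fin (suc n)) → ∃[ m ] SimplePath G m (vertex p i) y
  suffix {y = y} p zero = _ , subst (λ u → SimplePath G _ u y) (sym (start p)) p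
  suffix {n = suc n} {y = y} p (suc i) = suffix tail i
    where
      tail : SimplePath G n (vertex p (suc zero)) y
      tail = record
        { vertex   = vertex p ∘ suc
        ; start    = refl
        ; end      = end p
        ; distinct = suc-injective ∘ distinct p
        ; edge     = edge p ∘ suc
        }

  -- The rest of the walk is made simple first. If it already visits `x`, everything before that
  -- visit is a loop and is cut off; otherwise `x` can be put in front.
  loop-erase : DecidableEquality (Vertex G) → Star G._∼_ x y → ∃[ n ] SimplePath G n x y
  loop-erase _≟_ ε = 0 , trivialPath _
  loop-erase {x = x} _≟_ (e ◅ es) with n , p ← loop-erase _≟_ es | Fin.any? (λ i → vertex p i ≟ x)
  ... | yes (i , refl) = suffix p i
  ... | no  x∉p        = suc n , consPath e p λ i eq → x∉p (i , eq)

  -- A path with `2 + n` edges has `3 + n` vertices, so the excess of the cycle is `n`.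
  closed-path⇒cycle : SimplePath G (2 + n) x y → y G.∼ x → Cycle G
  closed-path⇒cycle {n = n} record { vertex = f ; start = refl ; end = refl ; distinct = d ; edge = e } closing =
    record { excess = n ; vertex = f ; distinct = d ; edge = e ; closing = closing }

-- Rooted trees

infixl 6 _⊲_

-- s ⊲ t hangs t below the root of s; the root of s stays the root.
data RootedTree : Set where
  leaf : RootedTree
  _⊲_  : (s t : RootedTree) → RootedTree

size : RootedTree → ℕ
size leaf    = 1
size (s ⊲ t) = size s + size t

depth : RootedTree → ℕ
depth leaf    = 0
depth (s ⊲ t) = suc (depth s ⊔ depth t)

0<size : ∀ t → 0 < size t
0<size leaf    = s≤s z≤n
0<size (s ⊲ t) = ≤-trans (0<size s) (m≤m+n _ _)

size≤2^depth : ∀ t → size t ≤ 2 ^ depth t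
size≤2^depth leaf    = ≤-refl
size≤2^depth (s ⊲ t) rewrite +-identityʳ (2 ^ (depth s ⊔ depth t)) = +-mono-≤
  (≤-trans (size≤2^depth s) (^-monoʳ-≤ 2 (m≤m⊔n (depth s) (depth t))))
  (≤-trans (size≤2^depth t) (^-monoʳ-≤ 2 (m≤n⊔m (depth s) (depth t))))

-- Chains of nested subterms

data _⊑_ : RootedTree → RootedTree → Set where
  self  : ∀ {t} → t ⊑ t
  left  : ∀ {r s t} → r ⊑ s → r ⊑ (s ⊲ t)
  right : ∀ {r s t} → r ⊑ t → r ⊑ (s ⊲ t)

-- Strictness is measured by size, the quantity that pumping has to decrease.
_⊏_ : RootedTree → RootedTree → Set
s ⊏ t = s ⊑ t × size s < size t

⊑⇒size≤ : ∀ {s t} → s ⊑ t → size s ≤ size t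
⊑⇒size≤ self      = ≤-refl
⊑⇒size≤ (left q)  = ≤-trans (⊑⇒size≤ q) (m≤m+n _ _)
⊑⇒size≤ (right q) = ≤-trans (⊑⇒size≤ q) (m≤n+m _ _)

⊏-left : ∀ {r s t} → r ⊑ s → r ⊏ (s ⊲ t)
⊏-left {s = s} {t} q = left q , ≤-trans (s≤s (⊑⇒size≤ q)) (m<m+n (size s) (0<size t))

⊏-right : ∀ {r s t} → r ⊑ t → r ⊏ (s ⊲ t)
⊏-right {s = s} {t} q = right q , ≤-trans (s≤s (⊑⇒size≤ q)) (m<n+m (size t) (0<size s))

Chain : ℕ → RootedTree → Set
Chain d t = Σ (Fin (suc d) → RootedTree) λ f →
  (∀ (i : Fin (suc d)) → f i ⊑ t) × (∀ {i j} → i Fin.< j → f j ⊏ f i)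

cons-chain : ∀ {d s t} → (∀ {r} → r ⊑ s → r ⊏ t) → Chain d s → Chain (suc d) t
cons-chain {t = t} s⊏t (f , f⊑s , f⊏) =
  (λ { zero → t ; (suc i) → f i }) ,
  (λ { zero → self ; (suc i) → proj₁ (s⊏t (f⊑s i)) }) ,
  (λ { {zero} {suc j} _ → s⊏t (f⊑s j) ; {suc i} {suc j} (s≤s i<j) → f⊏ i<j })

-- Descending into a deeper argument of each `⊲` lowers the depth by exactly one, so at least `d`
-- descents are possible.
chain : ∀ d t → d ≤ depth t → Chain d t
chain zero    t       _       = (λ _ → t) , (λ _ → self) , λ { {zero} {zero} () }
chain (suc d) (s ⊲ t) (s≤s q) with ⊔-sel (depth s) (depth t)
... | inj₁ eq = cons-chain ⊏-left  (chain d s (subst (d ≤_) eq q))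
... | inj₂ eq = cons-chain ⊏-right (chain d t (subst (d ≤_) eq q))

-- k-types over m pebbles: an atomic type is a table of m² pairs of bits, and
-- otherwise a type is a set of types with one more pebble.
types : ℕ → ℕ → ℕ
types zero    m = ((2 * 2) ^ m) ^ m
types (suc k) m = 2 ^ types k (suc m)

-- The graph of a rooted tree

module RootedTrees (ℓ : Level) where

  private
    variable
      s t : RootedTree

  -- Nodes live in `Set ℓ` so that `graph t` is among the graphs over which `Defines` quantifies at
  -- level `ℓ`.
  data Node : RootedTree → Set ℓ where
    here  : Node leaf
    left  : Node s → Node (s ⊲ t)
    right : Node t → Node (s ⊲ t)

  root : Node t
  root {leaf}  = here
  root {s ⊲ t} = left root

  left-injective : {x y : Node s} → left {t = t} x ≡ left y → x ≡ y
  left-injective refl = refl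

  right-injective : {x y : Node t} → right {s = s} x ≡ right y → x ≡ y
  right-injective refl = refl

  infix 4 _~_ _≟_

  _~_ : Node t → Node t → Set ℓ
  here    ~ here    = ⊥
  left x  ~ left y  = x ~ y
  left x  ~ right y = x ≡ root × y ≡ root
  right x ~ left y  = x ≡ root × y ≡ root
  right x ~ right y = x ~ y

  ~-sym : {x y : Node t} → x ~ y → y ~ x
  ~-sym {x = here}    {here}    ()
  ~-sym {x = left x}  {left y}  e       = ~-sym {x = x} e
  ~-sym {x = left x}  {right y} (p , q) = q , p
  ~-sym {x = right x} {left y}  (p , q) = q , p
  ~-sym {x = right x} {right y} e       = ~-sym {x = x} e

  ~-irrefl : (x : Node t) → ¬ x ~ x
  ~-irrefl here      ()
  ~-irrefl (left x)  = ~-irrefl x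
  ~-irrefl (right x) = ~-irrefl x

  graph : RootedTree → Graph ℓ
  graph t = record { Vertex = Node t ; _∼_ = _~_ ; ∼-sym = λ {x} → ~-sym {x = x} ; ∼-irrefl = ~-irrefl }

  _≟_ : DecidableEquality (Node t)
  here    ≟ here    = yes refl
  left x  ≟ left y  = map′ (cong left) left-injective (x ≟ y)
  left x  ≟ right y = no λ ()
  right x ≟ left y  = no λ ()
  right x ≟ right y = map′ (cong right) right-injective (x ≟ y)

  _~?_ : (x y : Node t) → Dec (x ~ y)
  here    ~? here    = no λ ()
  left x  ~? left y  = x ~? y
  left x  ~? right y = (x ≟ root) ×-dec (y ≟ root)
  right x ~? left y  = (x ≟ root) ×-dec (y ≟ root)
  right x ~? right y = x ~? y

  any? : {P : Pred (Node t) p} → Decidable P → Dec (∃ P)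
  any? {leaf} P? = map′ (here ,_) (λ { (here , px) → px }) (P? here)
  any? {s ⊲ t} P? = map′
    (λ { (inj₁ (x , px)) → left x , px ; (inj₂ (x , px)) → right x , px })
    (λ { (left x , px) → inj₁ (x , px) ; (right x , px) → inj₂ (x , px) })
    (any? (P? ∘ left) ⊎-dec any? (P? ∘ right))

  node↔fin : ∀ t → Node t ↔ Fin (size t)
  node↔fin leaf = mk↔ₛ′ (λ _ → zero) (λ _ → here) (λ { zero → refl }) (λ { here → refl })
  node↔fin (s ⊲ t) = ↔-sym +↔⊎ ↔-∘ ((node↔fin s ⊎-↔ node↔fin t) ↔-∘ node↔⊎)
    where
      node↔⊎ : Node (s ⊲ t) ↔ (Node s ⊎ Node t)
      node↔⊎ = mk↔ₛ′ (λ { (left x) → inj₁ x ; (right x) → inj₂ x }) (λ { (inj₁ x) → left x ; (inj₂ x) → right x })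
        (λ { (inj₁ x) → refl ; (inj₂ x) → refl }) (λ { (left x) → refl ; (right x) → refl })

  connected : (x y : Node t) → Star _~_ x y
  connected here      here      = ε
  connected (left x)  (left y)  = gmap left id (connected x y)
  connected (left x)  (right y) =
    gmap left id (connected x root) ◅◅ (refl , refl) ◅ gmap right id (connected root y)
  connected (right x) (left y)  =
    gmap right id (connected x root) ◅◅ (refl , refl) ◅ gmap left id (connected root y)
  connected (right x) (right y) = gmap right id (connected x y)

  -- Equivalence of rooted trees up to k rounds, and pumping

  Roots : Pairing (graph s) (graph t)
  Roots x y = x ≡ root × y ≡ root

  infix 4 _≃[_]_

  -- The roots are pebbled before the game starts, because the edge added by `⊲` is determined by
  -- them.
  _≃[_]_ : RootedTree → ℕ → RootedTree → Set ℓ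
  s ≃[ k ] t = EF (graph s) (graph t) k Roots

  ≃-refl : t ≃[ k ] t
  ≃-refl {t} {k} = ≅⇒EF ≅-refl k λ { _ _ (refl , refl) → refl }

  module _ {s s′ t t′ : RootedTree} where

    SumPairing : Pairing (graph s) (graph s′) → Pairing (graph t) (graph t′) →
                 Pairing (graph (s ⊲ t)) (graph (s′ ⊲ t′))
    SumPairing R S (left x)  (left y)  = R x y
    SumPairing R S (left x)  (right y) = ⊥
    SumPairing R S (right x) (left y)  = ⊥
    SumPairing R S (right x) (right y) = S x y

    -- Duplicator plays both games in parallel and answers in the component where Spoiler moved.
    EF-⊲ : ∀ k {R S} → R root root → S root root →
      EF (graph s) (graph s′) k R → EF (graph t) (graph t′) k S →
      EF (graph (s ⊲ t)) (graph (s′ ⊲ t′)) k (SumPairing R S)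
    EF-⊲ zero {R} {S} r₀ s₀ d e = iso
      where
        -- An edge between the components joins their roots. As the roots are pebbled, being a root
        -- is an equality between pebbled vertices and so is preserved.
        cross : ∀ {x x′ y y′} → R x x′ → S y y′ → (x ≡ root × y ≡ root) ⇔ (x′ ≡ root × y′ ≡ root)
        cross r s = proj₁ (d r r₀) ×-⇔ proj₁ (e s s₀)

        iso : IsPartialIso (graph (s ⊲ t)) (graph (s′ ⊲ t′)) (SumPairing R S)
        iso {left _}  {left _}  {left _}  {left _}  r r′ =
          mk⇔ (cong left ∘ to (proj₁ (d r r′)) ∘ left-injective)
              (cong left ∘ from (proj₁ (d r r′)) ∘ left-injective) , proj₂ (d r r′)
        iso {right _} {right _} {right _} {right _} r r′ =
          mk⇔ (cong right ∘ to (proj₁ (e r r′)) ∘ right-injective)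
              (cong right ∘ from (proj₁ (e r r′)) ∘ right-injective) , proj₂ (e r r′)
        iso {left _}  {right _} {left _}  {right _} r r′ = mk⇔ (λ ()) (λ ()) , cross r r′
        iso {right _} {left _}  {right _} {left _}  r r′ = mk⇔ (λ ()) (λ ()) , mk⇔ swap swap ⇔-∘ (cross r′ r ⇔-∘ mk⇔ swap swap)
    EF-⊲ (suc k) {R} {S} r₀ s₀ d@(forth₁ , back₁) e@(forth₂ , back₂) =
      (λ { (left x)  → let y , d′ = forth₁ x in left y , insertˡ d′
         ; (right x) → let y , e′ = forth₂ x in right y , insertʳ e′ }) ,
      (λ { (left y)  → let x , d′ = back₁ y in left x , insertˡ d′
         ; (right y) → let x , e′ = back₂ y in right x , insertʳ e′ })
      where
        insertˡ : ∀ {x y} → EF (graph s) (graph s′) k (Insert R x y) →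
          EF (graph (s ⊲ t)) (graph (s′ ⊲ t′)) k (Insert (SumPairing R S) (left x) (left y))
        insertˡ d′ = EF-antitone k
          (λ { (left _)  (left _)  (inj₁ r) → inj₁ r
             ; (right _) (right _) (inj₁ r) → r
             ; (left _)  (left _)  (inj₂ (refl , refl)) → inj₂ (refl , refl) })
          -- The component without a move discards one round, so both games again have `k` rounds
          -- left.
          (EF-⊲ k (inj₁ r₀) s₀ d′ (EF-pred root e))

        insertʳ : ∀ {x y} → EF (graph t) (graph t′) k (Insert S x y) →
          EF (graph (s ⊲ t)) (graph (s′ ⊲ t′)) k (Insert (SumPairing R S) (right x) (right y))
        insertʳ e′ = EF-antitone k
          (λ { (left _)  (left _)  (inj₁ r) → r
             ; (right _) (right _) (inj₁ r) → inj₁ r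
             ; (right _) (right _) (inj₂ (refl , refl)) → inj₂ (refl , refl) })
          (EF-⊲ k r₀ (inj₁ s₀) (EF-pred root d) e′)

    ≃-⊲ : s ≃[ k ] s′ → t ≃[ k ] t′ → s ⊲ t ≃[ k ] s′ ⊲ t′
    ≃-⊲ {k} d e = EF-antitone k (λ { (left _) (left _) (refl , refl) → refl , refl })
      (EF-⊲ k (refl , refl) (refl , refl) d e)

  -- By `≃-⊲` the equivalence is a congruence, so it and the drop in size propagate upwards from the
  -- replaced subterm to the whole term.
  replace : ∀ {r r′} → r ⊑ t → r′ ≃[ k ] r → size r′ < size r → ∃[ t′ ] (t′ ≃[ k ] t × size t′ < size t)
  replace self e lt = _ , e , lt
  replace {s ⊲ t} {k} (left q) e lt with s′ , e′ , lt′ ← replace q e lt =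
    s′ ⊲ t , ≃-⊲ e′ (≃-refl {k = k}) , +-mono-<-≤ lt′ (≤-refl {size t})
  replace {s ⊲ t} {k} (right q) e lt with t′ , e′ , lt′ ← replace q e lt =
    s ⊲ t′ , ≃-⊲ (≃-refl {k = k}) e′ , +-mono-≤-< (≤-refl {size s}) lt′

  pump : Classifier _≃[ k ]_ N → N ≤ depth t → ∃[ t′ ] (t′ ≃[ k ] t × size t′ < size t)
  pump {k} {N} {t} c N≤depth =
    let f , f⊑t , f⊏ = chain N t N≤depth
        -- The chain has `N + 1` terms and there are `N` labels. Since `i < j`, the term `f j` is
        -- the smaller one and takes the place of `f i`.
        i , j , i<j , eq = pigeonhole ≤-refl (classify c ∘ f)
    in replace (f⊑t i) (sound c (sym eq)) (proj₂ (f⊏ i<j))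

  -- Counting the types of pebbled trees

  Position : ℕ → Set ℓ
  Position m = Σ RootedTree λ t → Vec (Node t) m

  Pebbled : Vec (Node s) m → Vec (Node t) m → Pairing (graph s) (graph t)
  Pebbled ρ σ x y = ∃[ i ] (x ≡ lookup ρ i × y ≡ lookup σ i)

  SameType : ∀ k → Position m → Position m → Set ℓ
  SameType k (s , ρ) (t , σ) = EF (graph s) (graph t) k (Pebbled ρ σ)

  -- With no rounds left, the label tabulates equality and adjacency for each pair of pebbles.
  -- Otherwise it records, one bit per label, which labels arise by placing one more pebble;
  -- finiteness of the tree makes these bits decidable.
  type-classifier : ∀ k m → Classifier (SameType {m} k) (types k m)
  type-classifier zero m = weaken
    (λ { agree (i , refl , refl) (j , refl , refl) → agree i j })
    (∀-classifier λ i → ∀-classifier λ j → ×-classifier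
      (dec-classifier λ (t , ρ) → lookup ρ i ≟ lookup ρ j)
      (dec-classifier λ (t , ρ) → lookup ρ i ~? lookup ρ j))
  type-classifier (suc k) m = weaken refine
    (∀-classifier λ i → dec-classifier λ (t , ρ) → any? λ x → classify c (t , x ∷ ρ) Fin.≟ i)
    where
      c : Classifier (SameType {suc m} k) (types k (suc m))
      c = type-classifier k (suc m)

      split : {ρ : Vec (Node s) m} {σ : Vec (Node t) m} → ∀ {u v x y} →
        Insert (Pebbled ρ σ) u v x y → Pebbled (u ∷ ρ) (v ∷ σ) x y
      split (inj₁ (i , p , q)) = suc i , p , q
      split (inj₂ (p , q))     = zero , p , q

      Realises : Fin (types k (suc m)) → Pred (Position m) ℓ
      Realises i (t , ρ) = ∃[ x ] classify c (t , x ∷ ρ) ≡ i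

      refine : {P Q : Position m} → (∀ i → Realises i P ⇔ Realises i Q) → SameType (suc k) P Q
      refine agree =
        -- The label of the position extended by `x` is realised on the left by `x` itself, hence on
        -- the right by some `y`, which is Duplicator's answer.
        (λ x → let y , eq = to (agree _) (x , refl) in y , EF-antitone k (λ _ _ → split) (sound c (sym eq))) ,
        (λ y → let x , eq = from (agree _) (y , refl) in x , EF-antitone k (λ _ _ → split) (sound c eq))

  ≃-classifier : ∀ k → Classifier _≃[ k ]_ (types k 1)
  ≃-classifier k = record
    { classify = λ t → classify (type-classifier k 1) (t , root ∷ [])
    ; sound    = λ eq → EF-antitone k (λ _ _ → zero ,_) (sound (type-classifier k 1) eq)
    }

  -- Every finite tree is the graph of a rooted tree

  -- Each node is the `here` of exactly one `leaf` of the term; turning that leaf into `leaf ⊲ leaf`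
  -- hangs a new vertex below the node.
  attach : Node t → RootedTree
  attach here              = leaf ⊲ leaf
  attach (left {t = t} x)  = attach x ⊲ t
  attach (right {s = s} y) = s ⊲ attach y

  size-attach : (v : Node t) → size (attach v) ≡ suc (size t)
  size-attach here              = refl
  size-attach (left {t = t} x)  = cong (_+ size t) (size-attach x)
  size-attach (right {s = s} y) = trans (cong (size s +_) (size-attach y)) (+-suc (size s) _)

  -- The new leaf of attach v is the node sent to nothing.
  old : (v : Node t) → Node (attach v) → Maybe (Node t)
  old here      (left here)  = just here
  old here      (right here) = nothing
  old (left v)  (left x)     = map left (old v x)
  old (left v)  (right y)    = just (right y)
  old (right v) (left x)     = just (left x)
  old (right v) (right y)    = map right (old v y)

  old-root : (v : Node t) → old v root ≡ just root
  old-root here = refl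
  old-root (left v) rewrite old-root v = refl
  old-root (right v) = refl

  map-left≢right : (x : Maybe (Node s)) {y : Node t} → map left x ≢ just (right y)
  map-left≢right (just _) ()
  map-left≢right nothing  ()

  map-right≢left : (y : Maybe (Node t)) {x : Node s} → map right y ≢ just (left x)
  map-right≢left (just _) ()
  map-right≢left nothing  ()

  old-injective : (v : Node t) → Injective _≡_ _≡_ (old v)
  old-injective here {left here} {left here} eq = refl
  old-injective here {right here} {right here} eq = refl
  old-injective here {left here} {right here} ()
  old-injective here {right here} {left here} ()
  old-injective (left v) {left x} {left y} eq = cong left (old-injective v (map-injective left-injective eq))
  old-injective (left v) {left x} {right y} eq = contradiction eq (map-left≢right (old v x))
  old-injective (left v) {right x} {left y} eq = contradiction (sym eq) (map-left≢right (old v y))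
  old-injective (left v) {right x} {right y} refl = refl
  old-injective (right v) {left x} {left y} refl = refl
  old-injective (right v) {left x} {right y} eq = contradiction (sym eq) (map-right≢left (old v y))
  old-injective (right v) {right x} {left y} eq = contradiction eq (map-right≢left (old v x))
  old-injective (right v) {right x} {right y} eq = cong right (old-injective v (map-injective right-injective eq))

  old-is-root : (v : Node t) {x : Node (attach v)} → x ≡ root ⇔ old v x ≡ just root
  old-is-root v = mk⇔ (λ { refl → old-root v }) (λ eq → old-injective v (trans eq (sym (old-root v))))

  -- Adjacency in `graph t` enlarged by one vertex `nothing` whose only neighbour is `v`.
  Link : Node t → Maybe (Node t) → Maybe (Node t) → Set ℓ
  Link v (just x) (just y) = x ~ y
  Link v (just x) nothing  = x ≡ v
  Link v nothing  (just y) = y ≡ v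
  Link v nothing  nothing  = ⊥

  Link-sym : (v : Node t) (x y : Maybe (Node t)) → Link v x y ⇔ Link v y x
  Link-sym v (just x) (just y) = mk⇔ (~-sym {x = x}) (~-sym {x = y})
  Link-sym v (just x) nothing  = mk⇔ id id
  Link-sym v nothing  (just y) = mk⇔ id id
  Link-sym v nothing  nothing  = mk⇔ id id

  Link-left : (v : Node s) (x y : Maybe (Node s)) → Link v x y ⇔ Link (left {t = t} v) (map left x) (map left y)
  Link-left v (just x) (just y) = mk⇔ id id
  Link-left v (just x) nothing  = mk⇔ (cong left) left-injective
  Link-left v nothing  (just y) = mk⇔ (cong left) left-injective
  Link-left v nothing  nothing  = mk⇔ (λ ()) (λ ())

  Link-right : (v : Node t) (x y : Maybe (Node t)) → Link v x y ⇔ Link (right {s = s} v) (map right x) (map right y)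
  Link-right v (just x) (just y) = mk⇔ id id
  Link-right v (just x) nothing  = mk⇔ (cong right) right-injective
  Link-right v nothing  (just y) = mk⇔ (cong right) right-injective
  Link-right v nothing  nothing  = mk⇔ (λ ()) (λ ())

  Link-left-root : (v : Node s) (x : Node (attach v)) (y : Node t) →
    (x ≡ root × y ≡ root) ⇔ Link (left v) (map left (old v x)) (just (right y))
  Link-left-root v x y = join (old v x) ⇔-∘ (old-is-root v ×-⇔ ⇔-id _)
    where
      join : ∀ x → (x ≡ just root × y ≡ root) ⇔ Link (left v) (map left x) (just (right y))
      join (just x) = mk⇔ just-injective (cong just) ×-⇔ ⇔-id _
      join nothing  = mk⇔ (λ ()) (λ ())

  Link-right-root : (v : Node t) (y : Node (attach v)) (x : Node s) →
    (y ≡ root × x ≡ root) ⇔ Link (right v) (map right (old v y)) (just (left x))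
  Link-right-root v y x = join (old v y) ⇔-∘ (old-is-root v ×-⇔ ⇔-id _)
    where
      join : ∀ y → (y ≡ just root × x ≡ root) ⇔ Link (right v) (map right y) (just (left x))
      join (just y) = mk⇔ just-injective (cong just) ×-⇔ ⇔-id _
      join nothing  = mk⇔ (λ ()) (λ ())

  -- Identifies `attach v` with the one-vertex extension described by `Link`. In the mixed cases the
  -- edge joins two roots, and `old v` sends root to root.
  attach-~ : (v : Node t) (x y : Node (attach v)) → (x ~ y) ⇔ Link v (old v x) (old v y)
  attach-~ here (left here)  (left here)  = mk⇔ id id
  attach-~ here (left here)  (right here) = mk⇔ proj₁ (λ e → e , refl)
  attach-~ here (right here) (left here)  = mk⇔ proj₁ (λ e → e , refl)
  attach-~ here (right here) (right here) = mk⇔ id id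
  attach-~ (left v)  (left x)  (left y)  = Link-left v (old v x) (old v y) ⇔-∘ attach-~ v x y
  attach-~ (left v)  (left x)  (right y) = Link-left-root v x y
  attach-~ (left v)  (right x) (left y)  =
    Link-sym (left v) (map left (old v y)) _ ⇔-∘ (Link-left-root v y x ⇔-∘ mk⇔ swap swap)
  attach-~ (left v)  (right x) (right y) = mk⇔ id id
  attach-~ (right v) (left x)  (left y)  = mk⇔ id id
  attach-~ (right v) (left x)  (right y) =
    Link-sym (right v) (map right (old v y)) _ ⇔-∘ (Link-right-root v y x ⇔-∘ mk⇔ swap swap)
  attach-~ (right v) (right x) (left y)  = Link-right-root v x y
  attach-~ (right v) (right x) (right y) = Link-right v (old v x) (old v y) ⇔-∘ attach-~ v x y

  -- Growing an induced subtree to the whole tree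

  module _ {T : Graph ℓ} where
    open Graph T using (_∼_; ∼-sym)

    -- Adjacency is an equivalence, so the image is an induced subgraph.
    record Embedding (t : RootedTree) : Set ℓ where
      field
        embed     : Node t → Vertex T
        injective : Injective _≡_ _≡_ embed
        adjacency : ∀ x y → (x ~ y) ⇔ (embed x ∼ embed y)

    open Embedding

    module _ (e : Embedding t) where

      Image : Pred (Vertex T) ℓ
      Image z = ∃[ x ] embed e x ≡ z

      surjective⇒≅ : (∀ z → Image z) → graph t ≅ T
      surjective⇒≅ onto = record
        { bijection = mk↔ₛ′ (embed e) (proj₁ ∘ onto) (proj₂ ∘ onto) (λ x → injective e (proj₂ (onto _)))
        ; adjacency = adjacency e
        }

      -- A path of t between two neighbours of an outside vertex closes up through that vertex.
      outside-neighbour-unique : ¬ Cycle T → ∀ {z} → ¬ Image z →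
        ∀ {x y} → embed e x ∼ z → embed e y ∼ z → x ≡ y
      outside-neighbour-unique acyclic {z} z∉ {x} {y} x∼z y∼z with loop-erase _≟_ (connected x y)
      ... | zero  , p = trans (sym (start p)) (end p)
      ... | suc n , p = contradiction
        (closed-path⇒cycle (consPath (∼-sym x∼z) (mapPath p) λ i eq → z∉ (_ , eq)) y∼z) acyclic
        where
          mapPath : ∀ {n x y} → SimplePath (graph _) n x y → SimplePath T n (embed e x) (embed e y)
          mapPath p = record
            { vertex   = embed e ∘ vertex p
            ; start    = cong (embed e) (start p)
            ; end      = cong (embed e) (end p)
            ; distinct = distinct p ∘ injective e
            ; edge     = λ i → to (adjacency e _ _) (edge p i)
            }

      -- Acyclicity makes `v` the only node whose image is adjacent to `z`, so adding `z` as a leaf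
      -- at `v` keeps the subgraph induced.
      extend : ¬ Cycle T → ∀ {v z} → ¬ Image z → embed e v ∼ z → Embedding (attach v)
      extend acyclic {v} {z} z∉ v∼z = record
        { embed     = embed⁺ ∘ old v
        ; injective = old-injective v ∘ embed⁺-injective _ _
        ; adjacency = λ x y → embed⁺-adjacency (old v x) (old v y) ⇔-∘ attach-~ v x y
        }
        where
          embed⁺ : Maybe (Node t) → Vertex T
          embed⁺ = maybe (embed e) z

          embed⁺-injective : ∀ x y → embed⁺ x ≡ embed⁺ y → x ≡ y
          embed⁺-injective (just x) (just y) eq = cong just (injective e eq)
          embed⁺-injective (just x) nothing  eq = contradiction (x , eq) z∉
          embed⁺-injective nothing  (just y) eq = contradiction (y , sym eq) z∉
          embed⁺-injective nothing  nothing  eq = refl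

          neighbour : ∀ {x} → embed e x ∼ z → x ≡ v
          neighbour x∼z = outside-neighbour-unique acyclic z∉ x∼z v∼z

          embed⁺-adjacency : ∀ x y → Link v x y ⇔ (embed⁺ x ∼ embed⁺ y)
          embed⁺-adjacency (just x) (just y) = adjacency e x y
          embed⁺-adjacency (just x) nothing  = mk⇔ (λ { refl → v∼z }) neighbour
          embed⁺-adjacency nothing  (just y) = mk⇔ (λ { refl → ∼-sym v∼z }) (neighbour ∘ ∼-sym)
          embed⁺-adjacency nothing  nothing  = mk⇔ (λ ()) λ z∼z → contradiction z∼z (∼-irrefl T z)

    module _ (tree : IsTree T) (order : HasOrder T n) where
      private
        acyclic : ¬ Cycle T
        acyclic = proj₂ tree

        _≟ᵀ_ : DecidableEquality (Vertex T)
        _≟ᵀ_ = via-injection (↔⇒↣ order) Fin._≟_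

        image? : (e : Embedding t) → Decidable (Image e)
        image? e z = any? λ x → embed e x ≟ᵀ z

      size≤order : Embedding t → size t ≤ n
      size≤order {t} e = injective⇒≤ (λ eq →
        Injection.injective (↔⇒↣ (↔-sym (node↔fin t))) (injective e (Injection.injective (↔⇒↣ order) eq)))

      -- A largest induced subtree spans; d bounds the number of vertices still missing.
      spanning : ∀ d {t} → n < d + size t → Embedding t → ∃[ t′ ] graph t′ ≅ T
      spanning zero    n<size e = contradiction (size≤order e) (<⇒≱ n<size)
      spanning (suc d) {t} n<size e with Fin.any? (λ i → ¬? (image? e (Inverse.from order i)))
      ... | no ∄outside = t , surjective⇒≅ e λ z → decidable-stable (image? e z) λ z∉ →
              ∄outside (Inverse.to order z , z∉ ∘ subst (Image e) (Inverse.strictlyInverseʳ order z))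
      -- A walk from the image of the root to a missing vertex must leave the image, and does so
      -- along an edge from `embed e v` to an outside `z`.
      ... | yes (i , i∉) with _ , z , (v , refl) , z∉ , v∼z ←
              crossing {G = T} (image? e) (root , refl) i∉ (proj₂ (proj₁ tree) _ _) =
            spanning d (subst (n <_) d+size n<size) (extend e acyclic z∉ v∼z)
        where
          d+size : suc (d + size t) ≡ d + size (attach v)
          d+size = trans (sym (+-suc d (size t))) (cong (d +_) (sym (size-attach v)))

      finite-tree-≅ : ∃[ t ] graph t ≅ T
      finite-tree-≅ = spanning n {leaf} (m<m+n n (s≤s z≤n)) record
        { embed     = λ _ → proj₁ (proj₁ tree)
        ; injective = λ { {here} {here} _ → refl }
        ; adjacency = λ { here here → mk⇔ (λ ()) λ r∼r → contradiction r∼r (∼-irrefl T _) }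
        }

    -- The order of a tree defined by a sentence

    defined-order≤ : ∀ {φ} → IsTree T → HasOrder T n → Defines φ T → n ≤ 2 ^ types (rank φ) 1
    defined-order≤ {φ = φ} tree order (T⊨φ , unique) with t , t≅T ← finite-tree-≅ tree order =
      ≤-trans (injective⇒≤ (Injection.injective (↔⇒↣ T↔fin))) size≤
      where
        T↔fin : Fin _ ↔ Fin (size t)
        T↔fin = node↔fin t ↔-∘ (↔-sym (_≅_.bijection t≅T) ↔-∘ ↔-sym order)

        t⊨φ : graph t ⊨ φ
        t⊨φ = from (Sat-transfer φ {R = λ _ _ → ⊥} ≤-refl (≅⇒EF t≅T (rank φ) λ _ _ ()) λ ()) T⊨φ

        size≤ : size t ≤ 2 ^ types (rank φ) 1
        size≤ with types (rank φ) 1 ≤? depth t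
        ... | no  ≰depth = ≤-trans (size≤2^depth t) (^-monoʳ-≤ 2 (<⇒≤ (≰⇒> ≰depth)))
        ... | yes ≤depth with t′ , e , lt ← pump (≃-classifier (rank φ)) ≤depth =
          -- The pumped tree also satisfies the sentence, but it is too small to be isomorphic to
          -- `T`.
          contradiction (from (Sat-transfer φ ≤-refl e λ ()) t⊨φ) (unique (graph t′) λ t′≅T →
            <⇒≱ lt (injective⇒≤ (Injection.injective (↔⇒↣ (
              node↔fin t′ ↔-∘ (↔-sym (_≅_.bijection t′≅T) ↔-∘ (_≅_.bijection t≅T ↔-∘ ↔-sym (node↔fin t))))))))

-- Towers

n≤Tower-log* : ∀ n → n ≤ Tower (log* n)
n≤Tower-log* n = proj₁ (proj₂ (log*-least n))

log*-≤ : ∀ {n i} → n ≤ Tower i → log* n ≤ i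
log*-≤ {n} {i} = proj₂ (proj₂ (log*-least n)) i

-- Each round contributes one exponential and one more pebble, so the atomic table at the bottom is
-- over `k + m` pebbles.
types≤Tower : ∀ k {m i} → types 0 (k + m) ≤ Tower i → types k m ≤ Tower (k + i)
types≤Tower zero    q = q
types≤Tower (suc k) {m} {i} q = ^-monoʳ-≤ 2 (types≤Tower k (subst (λ l → types 0 l ≤ Tower i) (sym (+-suc k m)) q))

types₀≤Tower : ∀ {m i} → m ≤ Tower (suc i) → types 0 m ≤ Tower (4 + i)
types₀≤Tower {m} {i} m≤ = begin
  ((2 * 2) ^ m) ^ m         ≡⟨ ^-*-assoc 4 m m ⟩
  (2 ^ 2) ^ (m * m)         ≡⟨ ^-*-assoc 2 2 (m * m) ⟩
  2 ^ (2 * (m * m))         ≤⟨ ^-monoʳ-≤ 2 (*-monoʳ-≤ 2 (*-mono-≤ m≤ m≤)) ⟩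
  2 ^ (2 * (2 ^ T * 2 ^ T)) ≡⟨ cong (λ e → 2 ^ (2 * e)) (sym (^-distribˡ-+-* 2 T T)) ⟩
  2 ^ (2 ^ (1 + (T + T)))   ≤⟨ ^-monoʳ-≤ 2 (^-monoʳ-≤ 2 1+2T≤) ⟩
  Tower (4 + i)             ∎
  where
    open ≤-Reasoning
    T = Tower i

    -- With `m` at most `2 ^ T`, the table size is at most two exponentials of `1 + 2T`; bounding
    -- this by two exponentials of `T` gives the four levels above `Tower i`.
    1+2T≤ : 1 + (T + T) ≤ 2 ^ (2 ^ T)
    1+2T≤ = begin
      1 + (T + T)       ≤⟨ +-mono-≤ (n<2^n T) (<⇒≤ (n<2^n T)) ⟩
      2 ^ T + 2 ^ T     ≡⟨ cong (2 ^ T +_) (sym (+-identityʳ (2 ^ T))) ⟩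
      2 ^ suc T         ≤⟨ ^-monoʳ-≤ 2 (n<2^n T) ⟩
      2 ^ (2 ^ T)       ∎

theorem8p1 : (ℓ : Level) → ∃[ C ] (∀ (n : ℕ) → 1 ≤ n → ∀ (k : ℕ) → q-trees-is ℓ n k → log* n ≤ k + log* (log* n) + C)
-- Four levels come from the atomic table in `types₀≤Tower`, one from the outer power of two in
-- `defined-order≤`.
theorem8p1 ℓ = 5 , bound
  where
    bound : ∀ n → 1 ≤ n → ∀ k → q-trees-is ℓ n k → log* n ≤ k + log* (log* n) + 5
    bound n _ k ((T , tree , order , (φ , defines , refl) , _) , _) with ≤-total (log* n) k
    -- For `k` at least `log* n` the bound is immediate; the other case supplies the estimate of `k`
    -- by `log* n`.
    ... | inj₁ log*≤k = ≤-trans log*≤k (≤-trans (m≤m+n k _) (m≤m+n _ 5))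
    ... | inj₂ k≤log* = log*-≤ (begin
      n                         ≤⟨ defined-order≤ {φ = φ} tree order defines ⟩
      2 ^ types k 1             ≤⟨ ^-monoʳ-≤ 2 (types≤Tower k (types₀≤Tower {i = i} k+1≤)) ⟩
      Tower (suc (k + (4 + i))) ≡⟨ cong Tower height ⟩
      Tower (k + i + 5)         ∎)
      where
        open RootedTrees ℓ
        open ≤-Reasoning
        i = log* (log* n)

        height : suc (k + (4 + i)) ≡ k + i + 5
        height = trans (sym (+-suc k (4 + i))) (trans (cong (k +_) (+-comm 5 i)) (sym (+-assoc k i 5)))

        -- The pebbles are the root and one per round. The chain
        -- `k ≤ log* n ≤ Tower i < 2 ^ Tower i` absorbs the extra one.
        k+1≤ : k + 1 ≤ Tower (suc i)
        k+1≤ = subst (_≤ Tower (suc i)) (+-comm 1 k)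
          (≤-trans (s≤s (≤-trans k≤log* (n≤Tower-log* (log* n)))) (n<2^n (Tower i)))
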